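{- Let $T$ be a nontrivial tree (that is, a tree with at least two vertices). Then $\alpha_{\rm es}(T)=\alpha(T)-1$ if and only if $T$ is a star $K_{1,t}$ with $t\ge 1$, or $T\in \mathcal{A}\cup \mathcal{B} \cup \mathcal{C}$.
   Context: All graphs are finite and simple; $\alpha(G)$ is the independence number. For $B\subseteq V(G)$, $N[B]=\bigcup_{b\in B}N[b]$ and $N(B)=N[B]- B$. A set $B\subseteq V(G)$ is an externally supported independence set (ESI-set) if $B$ is independent and every $v\in N(B)$ has a neighbor in $V(G)- N[B]$ (the empty set is an ESI-set); $\alpha_{\rm es}(G)$ is the maximum cardinality of an ESI-set of $G$. Family $\mathcal{A}$: all trees obtained as follows. Start with a star $K_{1,t}$, $t\ge 2$, with center $x$; for each leaf $v$ of this star, attach $k_v\ge 1$ new leaves to $v$. Family $\mathcal{B}$: all trees obtained as follows. Start with a star $K_{1,t}$, $t\ge 2$, with center $x$; for each leaf $v$ of this star with the exception of precisely one leaf $y$, attach $k_v\ge 1$ new leaves to $v$ (so among the neighbors of $x$ only $y$ remains a leaf). Family $\mathcal{C}$: all trees obtained as follows. Start with a double star $S_{a,b}$, $a,b\ge 1$, i.e. the tree obtained from an edge $xy$ by attaching $a$ leaves to $x$ and $b$ leaves to $y$; for each leaf $v$ of $S_{a,b}$, attach $k_v\ge 1$ new leaves to $v$. -}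

module Defs where

open import Data.Empty using (⊥)
open import Data.Fin using (Fin)
import Data.Fin.Properties as Fin
open import Data.Fin.Subset using (Subset; inside; outside; _∈_; ∣_∣)
open import Data.Fin.Subset.Properties using (_∈?_)
open import Data.List.Base using (List; []; _∷_; _∷ʳ_; length; map; filter; cartesianProductWith)
open import Data.List.Extrema.Nat using (max)
open import Data.List.Relation.Unary.Linked using (Linked)
open import Data.List.Relation.Unary.Unique.Propositional using (Unique)
open import Data.Nat using (ℕ; zero; suc; _≤_)
open import Data.Product using (Σ; _×_; _,_; ∃; ∃-syntax)
import Data.Product.Properties as Product
open import Data.Sum using (_⊎_; inj₁; inj₂; [_,_]′)
import Data.Sum.Properties as Sum
open import Data.Vec using ([]; _∷_; lookup)
open import Function using (_∘_; const)
open import Function.Bundles using (_↔_; _⇔_; Inverse)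
open import Level using (0ℓ)
open import Relation.Binary using (Rel; Decidable; DecidableEquality; Symmetric; Irreflexive)
open import Relation.Binary.Construct.Closure.ReflexiveTransitive using (Star)
open import Relation.Binary.PropositionalEquality using (_≡_; _≢_; refl; sym; ≢-sym)
open import Relation.Nullary using (¬_; no)
open import Relation.Nullary.Decidable using (¬?; _×-dec_; _⊎-dec_; _→-dec_)
open import Relation.Unary using (Pred) renaming (Decidable to Decidable₁)

-- Finiteness is imposed by the choice of V: below, V is Fin n or a finite disjoint union of such types.
record Graph (V : Set) : Set₁ where
  field
    _∼_      : Rel V 0ℓ
    ∼-sym    : Symmetric _∼_
    ∼-irrefl : Irreflexive _≡_ _∼_
    _≟_      : DecidableEquality V
    _∼?_     : Decidable _∼_

infix 4 _≅_

record _≅_ {V W : Set} (G : Graph V) (H : Graph W) : Set where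
  private
    module G = Graph G
    module H = Graph H
  field
    bijection : V ↔ W
  open Inverse bijection public using (to)
  field
    adjacency : ∀ u v → (u G.∼ v) ⇔ (to u H.∼ to v)

module _ {V : Set} (G : Graph V) where
  open Graph G

  Connected : Set
  Connected = ∀ u v → Star _∼_ u v

  -- The cycle v, v₁, …, vₘ, v (m ≥ 2), with vs the list of v₁, …, vₘ.
  IsCycle : V → List V → Set
  IsCycle v vs = 2 ≤ length vs × Unique (v ∷ vs) × Linked _∼_ (v ∷ vs ∷ʳ v)

  Acyclic : Set
  Acyclic = ∀ v vs → ¬ IsCycle v vs

  IsTree : Set
  IsTree = Connected × Acyclic

allSubsets : ∀ n → List (Subset n)
allSubsets zero    = [] ∷ []
allSubsets (suc n) = cartesianProductWith _∷_ (inside ∷ outside ∷ []) (allSubsets n)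

-- The value is 0 if no subset satisfies P; both uses below have the empty set satisfying P.
maxCard : ∀ {n} {P : Pred (Subset n) 0ℓ} → Decidable₁ P → ℕ
maxCard {n} P? = max 0 (map ∣_∣ (filter P? (allSubsets n)))

module _ {n} (G : Graph (Fin n)) where
  open Graph G

  Independent : Pred (Subset n) 0ℓ
  Independent B = ∀ u v → u ∈ B → v ∈ B → ¬ (u ∼ v)

  N[_] : Fin n → Pred (Fin n) 0ℓ
  N[ b ] v = v ≡ b ⊎ b ∼ v

  ClosedNbhd : Subset n → Pred (Fin n) 0ℓ
  ClosedNbhd B v = ∃[ b ] b ∈ B × N[ b ] v

  OpenNbhd : Subset n → Pred (Fin n) 0ℓ
  OpenNbhd B v = ClosedNbhd B v × ¬ (v ∈ B)

  ESI : Pred (Subset n) 0ℓ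
  ESI B = Independent B × (∀ v → OpenNbhd B v → ∃[ w ] v ∼ w × ¬ ClosedNbhd B w)

  independent? : Decidable₁ Independent
  independent? B = Fin.all? λ u → Fin.all? λ v →
    (u ∈? B) →-dec ((v ∈? B) →-dec ¬? (u ∼? v))

  closedNbhd? : ∀ B → Decidable₁ (ClosedNbhd B)
  closedNbhd? B v = Fin.any? λ b → (b ∈? B) ×-dec ((v ≟ b) ⊎-dec (b ∼? v))

  openNbhd? : ∀ B → Decidable₁ (OpenNbhd B)
  openNbhd? B v = closedNbhd? B v ×-dec ¬? (v ∈? B)

  esi? : Decidable₁ ESI
  esi? B = independent? B ×-dec
    (Fin.all? λ v → openNbhd? B v →-dec (Fin.any? λ w → (v ∼? w) ×-dec ¬? (closedNbhd? B w)))

  α : ℕ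
  α = maxCard independent?

  αₑₛ : ℕ
  αₑₛ = maxCard esi?

K : ∀ n → Graph (Fin n)
K n = record
  { _∼_      = _≢_
  ; ∼-sym    = ≢-sym
  ; ∼-irrefl = λ u≡v u≢v → u≢v u≡v
  ; _≟_      = Fin._≟_
  ; _∼?_     = λ u v → ¬? (u Fin.≟ v)
  }

-- attachLeaves G k attaches k v new leaves to every vertex v of G: the vertex v of G
-- becomes inj₁ v, and its new leaves are inj₂ (v , i) for i : Fin (k v).
module _ {V : Set} (G : Graph V) (k : V → ℕ) where
  private
    module G = Graph G

    V′ : Set
    V′ = V ⊎ Σ V (Fin ∘ k)

    _∼′_ : Rel V′ 0ℓ
    inj₁ u       ∼′ inj₁ v       = u G.∼ v
    inj₁ u       ∼′ inj₂ (v , _) = u ≡ v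
    inj₂ (u , _) ∼′ inj₁ v       = u ≡ v
    inj₂ _       ∼′ inj₂ _       = ⊥

    ∼′-sym : Symmetric _∼′_
    ∼′-sym {inj₁ _} {inj₁ _} = G.∼-sym
    ∼′-sym {inj₁ _} {inj₂ _} = sym
    ∼′-sym {inj₂ _} {inj₁ _} = sym
    ∼′-sym {inj₂ _} {inj₂ _} ()

    ∼′-irrefl : Irreflexive _≡_ _∼′_
    ∼′-irrefl {inj₁ _} refl = G.∼-irrefl refl
    ∼′-irrefl {inj₂ _} refl ()

    _∼′?_ : Decidable _∼′_
    inj₁ u       ∼′? inj₁ v       = u G.∼? v
    inj₁ u       ∼′? inj₂ (v , _) = u G.≟ v
    inj₂ (u , _) ∼′? inj₁ v       = u G.≟ v
    inj₂ _       ∼′? inj₂ _       = no λ ()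

  attachLeaves : Graph (V ⊎ Σ V (Fin ∘ k))
  attachLeaves = record
    { _∼_      = _∼′_
    ; ∼-sym    = λ {u} {v} → ∼′-sym {u} {v}
    ; ∼-irrefl = λ {u} {v} → ∼′-irrefl {u} {v}
    ; _≟_      = Sum.≡-dec G._≟_ (Product.≡-dec G._≟_ Fin._≟_)
    ; _∼?_     = _∼′?_
    }

StarLeaf : ℕ → Set
StarLeaf t = Σ (Fin 1) (const (Fin t))

star : ∀ t → Graph (Fin 1 ⊎ StarLeaf t)
star t = attachLeaves (K 1) (const t)

DoubleStarLeaf : ℕ → ℕ → Set
DoubleStarLeaf a b = Σ (Fin 2) (Fin ∘ lookup (a ∷ b ∷ []))

doubleStar : ∀ a b → Graph (Fin 2 ⊎ DoubleStarLeaf a b)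
doubleStar a b = attachLeaves (K 2) (lookup (a ∷ b ∷ []))

-- In star t with t ≥ 2 and in doubleStar a b with a, b ≥ 1, the leaves (vertices of
-- degree one) are exactly the vertices of the form inj₂ _, so new leaves go only there.
atLeaves : {C L : Set} → (L → ℕ) → C ⊎ L → ℕ
atLeaves k = [ const 0 , k ]′

module _ {V : Set} (T : Graph V) where

  IsStar : Set
  IsStar = ∃[ t ] 1 ≤ t × T ≅ star t

  Family𝒜 : Set
  Family𝒜 = ∃[ t ] 2 ≤ t × Σ (StarLeaf t → ℕ) λ k →
    (∀ v → 1 ≤ k v) × T ≅ attachLeaves (star t) (atLeaves k)

  Familyℬ : Set
  Familyℬ = ∃[ t ] 2 ≤ t × Σ (StarLeaf t → ℕ) λ k → Σ (StarLeaf t) λ y →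
    k y ≡ 0 × (∀ v → v ≢ y → 1 ≤ k v) × T ≅ attachLeaves (star t) (atLeaves k)

  Family𝒞 : Set
  Family𝒞 = ∃[ a ] ∃[ b ] 1 ≤ a × 1 ≤ b × Σ (DoubleStarLeaf a b → ℕ) λ k →
    (∀ v → 1 ≤ k v) × T ≅ attachLeaves (doubleStar a b) (atLeaves k)

{-# OPTIONS --safe #-}
module Submission where

-- If B is a maximum ESI-set with |B| = α − 1, then two non-adjacent vertices outside N[B] would
-- extend B to an independent set of size α + 1, so V − N[B] is a clique: one vertex or the two
-- ends of an edge. Every vertex of N(B) has a neighbour in this core, and having no cycle of
-- length 3, 4 or 5 forces N(B) to be independent and every b ∈ B to be a leaf at a vertex of
-- N(B); this leaves only the listed trees. Conversely, given such a partition into B, N(B) and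
-- a clique core, B is an ESI-set, and replacing each support vertex by one of its leaves maps
-- any independent set injectively into B plus one point for the core, so α ≤ |B| + 1.
-- The reverse inequality αₑₛ < α holds since an ESI-set never dominates a graph with an edge.

open import Defs
open import Data.Empty using (⊥-elim)
open import Data.Fin using (Fin; zero; suc; fromℕ<)
import Data.Fin.Properties as Fin
open import Data.Fin.Subset using (Subset; inside; outside; _∈_; _∉_; ∣_∣; ⊥)
open import Data.Fin.Subset.Properties using (_∈?_; ∉⊥; ∣⊥∣≡0)
open import Data.List.Base using ([]; _∷_; map; filter)
open import Data.List.Extrema.Nat using (argmax-sel; v≤max⁺)
import Data.List.Membership.Propositional as List
open import Data.List.Membership.Propositional.Properties
  using (∈-map⁺; ∈-map⁻; ∈-filter⁺; ∈-filter⁻; ∈-cartesianProductWith⁺)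
import Data.List.Relation.Unary.Any as Any
open import Data.List.Relation.Unary.All using ([]; _∷_)
open import Data.List.Relation.Unary.AllPairs using ([]; _∷_)
open import Data.List.Relation.Unary.Linked using ([-]; _∷_)
open import Data.Nat using (ℕ; zero; suc; _+_; _≤_; z≤n; s≤s)
import Data.Nat.Properties as ℕ
open import Data.Product using (Σ; _×_; _,_; ∃; ∃-syntax; proj₁; proj₂)
import Data.Product.Properties as Product
open import Data.Sum using (_⊎_; inj₁; inj₂)
open import Data.Vec using ([]; _∷_; here; there; tabulate; lookup; _[_]≔_)
open import Data.Vec.Properties
  using (lookup∘tabulate; lookup⇒[]=; []=⇒lookup)
open import Function using (_∘_; const; id)
open import Function.Bundles using (_⇔_; mk⇔; mk↔ₛ′; Equivalence; Inverse)
open import Level using (0ℓ)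
open import Relation.Binary.Construct.Closure.ReflexiveTransitive using (_◅_)
open import Relation.Binary.PropositionalEquality
  using (_≡_; _≢_; refl; sym; trans; cong; subst; ≢-sym)
open import Relation.Nullary using (¬_; Dec; yes; no; does; contradiction)
open import Relation.Nullary.Decidable using (_×-dec_; ¬?; decidable-stable; dec-true)
open import Relation.Unary using (Pred) renaming (Decidable to Decidable₁)

-- Enumerations, subsets and maximum cardinality.

record Enumeration {n} (P : Pred (Fin n) 0ℓ) (m : ℕ) : Set where
  field
    elem      : Fin m → Fin n
    injective : ∀ {i j} → elem i ≡ elem j → i ≡ j
    sound     : ∀ i → P (elem i)
    complete  : ∀ v → P v → ∃[ i ] elem i ≡ v

enumerate : ∀ {n} (p : Subset n) → Enumeration (_∈ p) ∣ p ∣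
enumerate [] = record
  { elem = id ; injective = id ; sound = λ () ; complete = λ _ () }
enumerate (outside ∷ p) = record
  { elem      = suc ∘ elem
  ; injective = injective ∘ Fin.suc-injective
  ; sound     = there ∘ sound
  ; complete  = λ { (suc v) (there v∈p) → let i , eq = complete v v∈p in i , cong suc eq }
  }
  where open Enumeration (enumerate p)
enumerate (inside ∷ p) = record
  { elem      = λ { zero → zero ; (suc i) → suc (elem i) }
  ; injective = λ { {zero} {zero} _ → refl
                  ; {suc _} {suc _} eq → cong suc (injective (Fin.suc-injective eq)) }
  ; sound     = λ { zero → here ; (suc i) → there (sound i) }
  ; complete  = λ { zero here → zero , refl
                  ; (suc v) (there v∈p) → let i , eq = complete v v∈p in suc i , cong suc eq }
  }
  where open Enumeration (enumerate p)

select : ∀ {n} {P : Pred (Fin n) 0ℓ} → Decidable₁ P → Subset n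
select P? = tabulate (does ∘ P?)

module _ {n} {P : Pred (Fin n) 0ℓ} (P? : Decidable₁ P) where

  ∈-select⁺ : ∀ {v} → P v → v ∈ select P?
  ∈-select⁺ {v} pv =
    lookup⇒[]= v _ (trans (lookup∘tabulate (does ∘ P?) v) (dec-true (P? v) pv))

  ∈-select⁻ : ∀ {v} → v ∈ select P? → P v
  ∈-select⁻ {v} v∈ with P? v | trans (sym (lookup∘tabulate (does ∘ P?) v)) ([]=⇒lookup v∈)
  ... | yes pv | _  = pv
  ... | no  _  | ()

  -- `attachLeaves` indexes new leaves by `Fin`; enumerating a decidable set of neighbours yields
  -- both their number and such an indexing.
  enumerateDec : ∃ (Enumeration P)
  enumerateDec = _ , record
    { elem      = elem
    ; injective = injective
    ; sound     = ∈-select⁻ ∘ sound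
    ; complete  = λ v → complete v ∘ ∈-select⁺
    }
    where open Enumeration (enumerate (select P?))

∣p[x]≔inside∣ : ∀ {n} (p : Subset n) {x} → x ∉ p → ∣ p [ x ]≔ inside ∣ ≡ suc ∣ p ∣
∣p[x]≔inside∣ (inside  ∷ p) {zero}  x∉p = contradiction here x∉p
∣p[x]≔inside∣ (outside ∷ p) {zero}  x∉p = refl
∣p[x]≔inside∣ (inside  ∷ p) {suc x} x∉p = cong suc (∣p[x]≔inside∣ p (x∉p ∘ there))
∣p[x]≔inside∣ (outside ∷ p) {suc x} x∉p = ∣p[x]≔inside∣ p (x∉p ∘ there)

∈-≔inside⁻ : ∀ {n} (p : Subset n) x {v} → v ∈ p [ x ]≔ inside → v ≡ x ⊎ v ∈ p
∈-≔inside⁻ (_ ∷ p) zero    here       = inj₁ refl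
∈-≔inside⁻ (_ ∷ p) zero    (there v∈) = inj₂ (there v∈)
∈-≔inside⁻ (_ ∷ p) (suc x) here       = inj₂ here
∈-≔inside⁻ (_ ∷ p) (suc x) (there v∈) with ∈-≔inside⁻ p x v∈
... | inj₁ eq  = inj₁ (cong suc eq)
... | inj₂ v∈p = inj₂ (there v∈p)

∈-allSubsets : ∀ {n} (p : Subset n) → p List.∈ allSubsets n
∈-allSubsets []            = Any.here refl
∈-allSubsets (inside  ∷ p) =
  ∈-cartesianProductWith⁺ _∷_ {inside ∷ outside ∷ []} (Any.here refl) (∈-allSubsets p)
∈-allSubsets (outside ∷ p) =
  ∈-cartesianProductWith⁺ _∷_ {inside ∷ outside ∷ []} (Any.there (Any.here refl)) (∈-allSubsets p)

module _ {n} {P : Pred (Subset n) 0ℓ} (P? : Decidable₁ P) where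

  ∣p∣≤maxCard : ∀ {p} → P p → ∣ p ∣ ≤ maxCard P?
  ∣p∣≤maxCard {p} pp = v≤max⁺ 0 _
    (inj₂ (List.lose (∈-map⁺ ∣_∣ (∈-filter⁺ P? (∈-allSubsets p) pp)) ℕ.≤-refl))

  maxCard-attained : P ⊥ → ∃[ p ] P p × ∣ p ∣ ≡ maxCard P?
  maxCard-attained p⊥ with argmax-sel id 0 (map ∣_∣ (filter P? (allSubsets n)))
  -- Here `max` returns its default value 0, which is the cardinality of the empty set.
  ... | inj₁ eq = ⊥ , p⊥ , trans (∣⊥∣≡0 n) (sym eq)
  ... | inj₂ m∈ with p , p∈ , eq ← ∈-map⁻ ∣_∣ m∈ =
    p , proj₂ (∈-filter⁻ P? {xs = allSubsets n} p∈) , sym eq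

-- Short cycles in acyclic graphs.

module _ {V : Set} (G : Graph V) where
  open Graph G

  adjacent⇒≢ : ∀ {u v} → u ∼ v → u ≢ v
  adjacent⇒≢ u∼v u≡v = ∼-irrefl u≡v u∼v

  module _ (acyclic : Acyclic G) where

    no-triangle : ∀ {a b c} → a ∼ b → b ∼ c → ¬ (c ∼ a)
    no-triangle {a} {b} {c} ab bc ca = acyclic a (b ∷ c ∷ [])
      ( s≤s (s≤s z≤n)
      , (adjacent⇒≢ ab ∷ ≢-sym (adjacent⇒≢ ca) ∷ []) ∷ (adjacent⇒≢ bc ∷ []) ∷ [] ∷ []
      , ab ∷ bc ∷ ca ∷ [-] )

    -- Consecutive vertices differ by irreflexivity, so only the two diagonals have to be assumed
    -- distinct.
    no-4-cycle : ∀ {a b c d} → a ≢ c → b ≢ d → a ∼ b → b ∼ c → c ∼ d → ¬ (d ∼ a)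
    no-4-cycle {a} {b} {c} {d} a≢c b≢d ab bc cd da = acyclic a (b ∷ c ∷ d ∷ [])
      ( s≤s (s≤s z≤n)
      , (adjacent⇒≢ ab ∷ a≢c ∷ ≢-sym (adjacent⇒≢ da) ∷ [])
        ∷ (adjacent⇒≢ bc ∷ b≢d ∷ []) ∷ (adjacent⇒≢ cd ∷ []) ∷ [] ∷ []
      , ab ∷ bc ∷ cd ∷ da ∷ [-] )

    -- Identifying two non-consecutive vertices of a closed walk of length 5 leaves a triangle.
    no-5-cycle : ∀ {a b c d e} → a ∼ b → b ∼ c → c ∼ d → d ∼ e → ¬ (e ∼ a)
    no-5-cycle {a} {b} {c} {d} {e} ab bc cd de ea = acyclic a (b ∷ c ∷ d ∷ e ∷ [])
      ( s≤s (s≤s z≤n)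
      , (adjacent⇒≢ ab ∷ a≢c ∷ a≢d ∷ ≢-sym (adjacent⇒≢ ea) ∷ [])
        ∷ (adjacent⇒≢ bc ∷ b≢d ∷ b≢e ∷ []) ∷ (adjacent⇒≢ cd ∷ c≢e ∷ [])
        ∷ (adjacent⇒≢ de ∷ []) ∷ [] ∷ []
      , ab ∷ bc ∷ cd ∷ de ∷ ea ∷ [-] )
      where
      a≢c : a ≢ c
      a≢c refl = no-triangle cd de ea
      a≢d : a ≢ d
      a≢d refl = no-triangle ab bc cd
      b≢d : b ≢ d
      b≢d refl = no-triangle ab de ea
      b≢e : b ≢ e
      b≢e refl = no-triangle bc cd de
      c≢e : c ≢ e
      c≢e refl = no-triangle ab bc ea

-- A path to a different vertex cannot be empty, and its first edge gives the neighbour.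
connected⇒neighbour : ∀ {n} {G : Graph (Fin n)} → 2 ≤ n → Connected G →
                      ∀ v → ∃[ w ] Graph._∼_ G v w
connected⇒neighbour {suc (suc _)} _ connected zero with connected zero (suc zero)
... | v∼w ◅ _ = _ , v∼w
connected⇒neighbour {suc (suc _)} _ connected (suc v) with connected (suc v) zero
... | v∼w ◅ _ = _ , v∼w
connected⇒neighbour {suc zero} (s≤s ())

-- Layerings and the two bounds relating `α` and `αₑₛ`.

Layer : Set
Layer = Fin 3

pattern core    = zero
pattern support = suc zero
pattern leaf    = suc (suc zero)

-- The leaf layer is an ESI-set B, the support layer is N(B), and the core is the rest.
record Layering {V : Set} (G : Graph V) : Set where
  open Graph G
  field
    layer        : V → Layer
    core-clique  : ∀ {u v} → layer u ≡ core → layer v ≡ core → u ≢ v → u ∼ v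
    support-core : ∀ {v} → layer v ≡ support → ∃[ w ] v ∼ w × layer w ≡ core
    support-leaf : ∀ {v} → layer v ≡ support → ∃[ w ] v ∼ w × layer w ≡ leaf
    leaf-support : ∀ {v w} → layer v ≡ leaf → v ∼ w → layer w ≡ support
    leaf-unique  : ∀ {v u w} → layer v ≡ leaf → v ∼ u → v ∼ w → u ≡ w

module _ {n} (G : Graph (Fin n)) where
  open Graph G

  independent-insert : ∀ {B x} → Independent G B → ¬ ClosedNbhd G B x →
                       Independent G (B [ x ]≔ inside)
  independent-insert {B} {x} indep x∉N u v u∈ v∈ u∼v
    with ∈-≔inside⁻ B x u∈ | ∈-≔inside⁻ B x v∈
  ... | inj₁ refl | inj₁ refl = ∼-irrefl refl u∼v
  ... | inj₁ refl | inj₂ v∈B  = x∉N (v , v∈B , inj₂ (∼-sym u∼v))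
  ... | inj₂ u∈B  | inj₁ refl = x∉N (u , u∈B , inj₂ u∼v)
  ... | inj₂ u∈B  | inj₂ v∈B  = indep u v u∈B v∈B u∼v

  -- This permits a second insertion: two distinct non-adjacent vertices outside N[B] can be added
  -- to `B` one after the other.
  ∉ClosedNbhd-insert : ∀ {B x y} → x ≢ y → ¬ (x ∼ y) → ¬ ClosedNbhd G B y →
                       ¬ ClosedNbhd G (B [ x ]≔ inside) y
  ∉ClosedNbhd-insert {B} {x} x≢y x≁y y∉N (b , b∈ , y∈N[b])
    with ∈-≔inside⁻ B x b∈ | y∈N[b]
  ... | inj₁ refl | inj₁ refl = x≢y refl
  ... | inj₁ refl | inj₂ x∼y  = x≁y x∼y
  ... | inj₂ b∈B  | _         = y∉N (b , b∈B , y∈N[b])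

  ∉ClosedNbhd⇒∉ : ∀ {B v} → ¬ ClosedNbhd G B v → v ∉ B
  ∉ClosedNbhd⇒∉ v∉N v∈B = v∉N (_ , v∈B , inj₁ refl)

  ∣insert∣≤α : ∀ {B x} → Independent G B → ¬ ClosedNbhd G B x → suc ∣ B ∣ ≤ α G
  ∣insert∣≤α {B} indep x∉N = subst (_≤ α G) (∣p[x]≔inside∣ B (∉ClosedNbhd⇒∉ x∉N))
    (∣p∣≤maxCard (independent? G) (independent-insert indep x∉N))

  esi-∅ : ESI G ⊥
  esi-∅ = (λ _ _ u∈ → contradiction u∈ ∉⊥)
        , (λ { _ ((_ , b∈ , _) , _) → contradiction b∈ ∉⊥ })

  -- Some end of the edge lies outside the independent set `B`. Either it is outside N[B], or it
  -- belongs to N(B) and external support supplies a neighbour outside N[B].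
  esi⇒∃∉ClosedNbhd : ∀ {B} → (∃[ u ] ∃[ v ] u ∼ v) → ESI G B → ∃[ v ] ¬ ClosedNbhd G B v
  esi⇒∃∉ClosedNbhd {B} (u , v , u∼v) (indep , es) with u ∈? B | v ∈? B
  ... | yes u∈B | yes v∈B = contradiction u∼v (indep u v u∈B v∈B)
  ... | no u∉B  | _ with closedNbhd? G B u
  ...   | no  u∉N = u , u∉N
  ...   | yes u∈N = let w , _ , w∉N = es u (u∈N , u∉B) in w , w∉N
  esi⇒∃∉ClosedNbhd {B} (u , v , u∼v) (indep , es) | yes _ | no v∉B with closedNbhd? G B v
  ...   | no  v∉N = v , v∉N
  ...   | yes v∈N = let w , _ , w∉N = es v (v∈N , v∉B) in w , w∉N

  αₑₛ<α : (∃[ u ] ∃[ v ] u ∼ v) → suc (αₑₛ G) ≤ α G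
  αₑₛ<α edge with maxCard-attained (esi? G) esi-∅
  ... | B , esi , ∣B∣≡αₑₛ = subst (λ m → suc m ≤ α G) ∣B∣≡αₑₛ
    (∣insert∣≤α (proj₁ esi) (proj₂ (esi⇒∃∉ClosedNbhd edge esi)))

  module _ (L : Layering G) where
    open Layering L

    leaf? : Decidable₁ (λ v → layer v ≡ leaf)
    leaf? v = layer v Fin.≟ leaf

    leaves : Subset n
    leaves = select leaf?

    -- All neighbours of the leaf layer are support vertices. Hence the core avoids N[leaves], and
    -- every vertex of N(leaves) has a core neighbour as its external support.
    leaves-esi : ESI G leaves
    leaves-esi = indep , es
      where
      indep : Independent G leaves
      indep u v u∈ v∈ u∼v
        with () ← trans (sym (∈-select⁻ leaf? v∈)) (leaf-support (∈-select⁻ leaf? u∈) u∼v)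
      core∉N : ∀ {w} → layer w ≡ core → ¬ ClosedNbhd G leaves w
      core∉N c (b , b∈ , inj₁ refl) with () ← trans (sym c) (∈-select⁻ leaf? b∈)
      core∉N c (b , b∈ , inj₂ b∼w) with () ← trans (sym c) (leaf-support (∈-select⁻ leaf? b∈) b∼w)
      es : ∀ v → OpenNbhd G leaves v → ∃[ w ] v ∼ w × ¬ ClosedNbhd G leaves w
      es v ((b , b∈ , inj₁ refl) , v∉) = contradiction b∈ v∉
      es v ((b , b∈ , inj₂ b∼v) , _) =
        let w , v∼w , c = support-core (leaf-support (∈-select⁻ leaf? b∈) b∼v)
        in w , v∼w , core∉N c

    -- Sending leaves to themselves, support vertices to one of their leaves and all core
    -- vertices to one extra point is injective on an independent set.
    data Image (v : Fin n) : Fin (suc ∣ leaves ∣) → Set where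
      isCore    : layer v ≡ core → Image v zero
      isSupport : ∀ i → v ∼ Enumeration.elem (enumerate leaves) i → Image v (suc i)
      isLeaf    : ∀ i → Enumeration.elem (enumerate leaves) i ≡ v → Image v (suc i)

    image : ∀ v → ∃ (Image v)
    image v with layer v in eq
    ... | core    = zero , isCore eq
    ... | support =
      let w , v∼w , w-leaf = support-leaf eq
          i , elem≡w = Enumeration.complete (enumerate leaves) w (∈-select⁺ leaf? w-leaf)
      in suc i , isSupport i (subst (v ∼_) (sym elem≡w) v∼w)
    ... | leaf    =
      let i , elem≡v = Enumeration.complete (enumerate leaves) v (∈-select⁺ leaf? eq)
      in suc i , isLeaf i elem≡v

    -- Distinct core vertices are adjacent, two support vertices sharing a leaf coincide by
    -- `leaf-unique`, and a support vertex is adjacent to its chosen leaf. The equation `i ≡ j` is a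
    -- separate argument so that matching on `refl` aligns the indices of the two `Image` proofs.
    image-injective : ∀ {u v i j} → i ≡ j → Image u i → Image v j → ¬ (u ∼ v) → u ≡ v
    image-injective {u} {v} refl (isCore cu) (isCore cv) u≁v =
      decidable-stable (u Fin.≟ v) (u≁v ∘ core-clique cu cv)
    image-injective refl (isSupport i u∼) (isSupport .i v∼) u≁v =
      leaf-unique (∈-select⁻ leaf? (Enumeration.sound (enumerate leaves) i)) (∼-sym u∼) (∼-sym v∼)
    image-injective refl (isSupport i u∼) (isLeaf .i refl) u≁v = contradiction u∼ u≁v
    image-injective refl (isLeaf i refl) (isSupport .i v∼) u≁v = contradiction (∼-sym v∼) u≁v
    image-injective refl (isLeaf i refl) (isLeaf .i refl) u≁v = refl

    ∣independent∣≤1+∣leaves∣ : ∀ {I} → Independent G I → ∣ I ∣ ≤ suc ∣ leaves ∣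
    ∣independent∣≤1+∣leaves∣ {I} indep = Fin.injective⇒≤ {f = proj₁ ∘ image ∘ elem} λ {i} {j} eq →
      injective (image-injective eq (proj₂ (image (elem i))) (proj₂ (image (elem j)))
        (indep (elem i) (elem j) (sound i) (sound j)))
      where open Enumeration (enumerate I)

    α≤1+αₑₛ : α G ≤ suc (αₑₛ G)
    α≤1+αₑₛ with maxCard-attained (independent? G) (proj₁ esi-∅)
    ... | I , indep , ∣I∣≡α = subst (_≤ suc (αₑₛ G)) ∣I∣≡α
      (ℕ.≤-trans (∣independent∣≤1+∣leaves∣ indep) (s≤s (∣p∣≤maxCard (esi? G) leaves-esi)))

  layering⇒αₑₛ+1≡α : (∃[ u ] ∃[ v ] u ∼ v) → Layering G → αₑₛ G + 1 ≡ α G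
  layering⇒αₑₛ+1≡α edge L =
    trans (ℕ.+-comm (αₑₛ G) 1) (ℕ.≤-antisym (αₑₛ<α edge) (α≤1+αₑₛ L))

-- From the equality to a layering.

αₑₛ+1≡α⇒layering : ∀ {n} (G : Graph (Fin n)) → Acyclic G → αₑₛ G + 1 ≡ α G → Layering G
αₑₛ+1≡α⇒layering {n} G acyclic αₑₛ+1≡α with maxCard-attained (esi? G) (esi-∅ G)
... | B , (indep , es) , ∣B∣≡αₑₛ = record
  { layer        = proj₁ ∘ place
  ; core-clique  = λ cu cv → clique (placed cu) (placed cv)
  ; support-core = λ sv → let w , v∼w , w∉N = es _ (placed sv) in w , v∼w , layered w∉N
  ; support-leaf = λ sv → near-leaf (placed sv)
  ; leaf-support = λ lv v∼w → layered (open-nbhd (placed lv) v∼w)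
  ; leaf-unique  = λ lv → unique (placed lv)
  }
  where
  open Graph G

  Place : Fin n → Layer → Set
  Place v core    = ¬ ClosedNbhd G B v
  Place v support = OpenNbhd G B v
  Place v leaf    = v ∈ B

  place : ∀ v → ∃ (Place v)
  place v with v ∈? B | closedNbhd? G B v
  ... | yes v∈B | _       = leaf , v∈B
  ... | no  v∉B | yes v∈N = support , v∈N , v∉B
  ... | no  v∉B | no  v∉N = core , v∉N

  -- The three places exclude one another, which lets `layered` turn any fact about `B` and N[B]
  -- into the value computed by `place`.
  place-unique : ∀ {v} k l → Place v k → Place v l → k ≡ l
  place-unique core    core    _ _ = refl
  place-unique core    support v∉N (v∈N , _) = contradiction v∈N v∉N
  place-unique core    leaf    v∉N v∈B = contradiction v∈B (∉ClosedNbhd⇒∉ G v∉N)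
  place-unique support core    (v∈N , _) v∉N = contradiction v∈N v∉N
  place-unique support support _ _ = refl
  place-unique support leaf    (_ , v∉B) v∈B = contradiction v∈B v∉B
  place-unique leaf    core    v∈B v∉N = contradiction v∈B (∉ClosedNbhd⇒∉ G v∉N)
  place-unique leaf    support v∈B (_ , v∉B) = contradiction v∈B v∉B
  place-unique leaf    leaf    _ _ = refl

  placed : ∀ {v l} → proj₁ (place v) ≡ l → Place v l
  placed {v} refl = proj₂ (place v)

  layered : ∀ {v l} → Place v l → proj₁ (place v) ≡ l
  layered {v} = place-unique _ _ (proj₂ (place v))

  open-nbhd : ∀ {v w} → v ∈ B → v ∼ w → OpenNbhd G B w
  open-nbhd v∈B v∼w = (_ , v∈B , inj₂ v∼w) , λ w∈B → indep _ _ v∈B w∈B v∼w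

  clique : ∀ {u v} → ¬ ClosedNbhd G B u → ¬ ClosedNbhd G B v → u ≢ v → u ∼ v
  clique {u} {v} u∉N v∉N u≢v = decidable-stable (u ∼? v) λ u≁v →
    ℕ.1+n≰n (ℕ.≤-trans (too-large u≁v) (ℕ.≤-reflexive α≡1+∣B∣))
    where
    α≡1+∣B∣ : α G ≡ suc ∣ B ∣
    α≡1+∣B∣ = trans (sym αₑₛ+1≡α) (trans (ℕ.+-comm (αₑₛ G) 1) (cong suc (sym ∣B∣≡αₑₛ)))
    too-large : ¬ (u ∼ v) → suc (suc ∣ B ∣) ≤ α G
    too-large u≁v = subst (λ m → suc m ≤ α G) (∣p[x]≔inside∣ B (∉ClosedNbhd⇒∉ G u∉N))
      (∣insert∣≤α G (independent-insert G indep u∉N) (∉ClosedNbhd-insert G u≢v u≁v v∉N))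

  near-leaf : ∀ {v} → OpenNbhd G B v → ∃[ w ] v ∼ w × proj₁ (place w) ≡ leaf
  near-leaf ((b , b∈B , inj₁ refl) , v∉B) = contradiction b∈B v∉B
  near-leaf ((b , b∈B , inj₂ b∼v) , _)    = b , ∼-sym b∼v , layered b∈B

  -- Distinct neighbours `u` and `w` of `v` lie in N(B), so they have neighbours `p` and `q` outside
  -- N[B]. If `p` and `q` coincide, a 4-cycle through `v` arises; otherwise they are adjacent by
  -- `clique` and close a 5-cycle.
  unique : ∀ {v u w} → v ∈ B → v ∼ u → v ∼ w → u ≡ w
  unique {v} {u} {w} v∈B v∼u v∼w = decidable-stable (u Fin.≟ w) λ u≢w →
    let p , u∼p , p∉N = es u (open-nbhd v∈B v∼u)
        q , w∼q , q∉N = es w (open-nbhd v∈B v∼w)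
    in short-cycle u≢w u∼p p∉N w∼q q∉N
    where
    short-cycle : ∀ {p q} → u ≢ w → u ∼ p → ¬ ClosedNbhd G B p →
                  w ∼ q → ¬ ¬ ClosedNbhd G B q
    short-cycle {p} {q} u≢w u∼p p∉N w∼q q∉N with p Fin.≟ q
    ... | yes refl = no-4-cycle G acyclic (λ { refl → ∉ClosedNbhd⇒∉ G p∉N v∈B }) u≢w
                       v∼u u∼p (∼-sym w∼q) (∼-sym v∼w)
    ... | no  p≢q  = no-5-cycle G acyclic v∼u u∼p (clique p∉N q∉N p≢q) (∼-sym w∼q) (∼-sym v∼w)

-- Isomorphisms built up level by level from induced subgraphs.

record Induced {n} (T : Graph (Fin n)) {V : Set} (H : Graph V) (Q : Pred (Fin n) 0ℓ) : Set where
  private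
    module T = Graph T
    module H = Graph H
  field
    ι         : V → Fin n
    injective : ∀ {u v} → ι u ≡ ι v → u ≡ v
    sound     : ∀ u → Q (ι u)
    complete  : ∀ v → Q v → ∃[ u ] ι u ≡ v
    adjacency : ∀ u v → (u H.∼ v) ⇔ (ι u T.∼ ι v)

module _ {n} {T : Graph (Fin n)} {V : Set} {H : Graph V} {Q : Pred (Fin n) 0ℓ}
         (I : Induced T H Q) where
  open Graph T
  open Induced I

  induced-resp : ∀ {Q′ : Pred (Fin n) 0ℓ} → (∀ {v} → Q v → Q′ v) → (∀ {v} → Q′ v → Q v) →
                 Induced T H Q′
  induced-resp f g = record
    { ι         = ι
    ; injective = injective
    ; sound     = f ∘ sound
    ; complete  = λ v → complete v ∘ g
    ; adjacency = adjacency
    }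

  induced⇒≅ : (∀ v → Q v) → T ≅ H
  induced⇒≅ total = record
    { bijection = mk↔ₛ′ to ι (λ u → injective (ι∘to (ι u))) ι∘to
    ; adjacency = λ u v →
        let open Equivalence (adjacency (to u) (to v)) renaming (to to ⇒; from to ⇐)
        in mk⇔ (λ u∼v → ⇐ (subst (_∼ ι (to v)) (sym (ι∘to u)) (subst (u ∼_) (sym (ι∘to v)) u∼v)))
               (λ u∼v → subst (u ∼_) (ι∘to v) (subst (_∼ ι (to v)) (ι∘to u) (⇒ u∼v)))
    }
    where
    to : Fin n → V
    to v = proj₁ (complete v (total v))
    ι∘to : ∀ v → ι (to v) ≡ v
    ι∘to v = proj₂ (complete v (total v))

  -- Adds one level to an induced copy of `H`. Each vertex of `L` has exactly one neighbour in `Q`,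
  -- so it is determined by this parent and its index among the parent's neighbours in `L`;
  -- independence of `L` rules out further edges.
  attach : ∀ {L : Pred (Fin n) 0ℓ} {k : V → ℕ} →
           (∀ {v} → Q v → ¬ L v) →
           (∀ {u v} → L u → L v → ¬ (u ∼ v)) →
           (∀ {w} → L w → ∃[ u ] Q u × u ∼ w) →
           (∀ {w u v} → L w → Q u → Q v → u ∼ w → v ∼ w → u ≡ v) →
           (∀ v → Enumeration (λ w → L w × ι v ∼ w) (k v)) →
           Induced T (attachLeaves H k) (λ v → Q v ⊎ L v)
  attach {L} {k} disjoint indep parent parent-unique enum = record
    { ι         = ι′
    ; injective = λ {u} {v} → injective′ u v
    ; sound     = λ { (inj₁ u) → inj₁ (sound u) ; (inj₂ (u , i)) → inj₂ (proj₁ (E.sound u i)) }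
    ; complete  = complete′
    ; adjacency = adjacency′
    }
    where
    module E v = Enumeration (enum v)

    ι′ : V ⊎ Σ V (Fin ∘ k) → Fin n
    ι′ (inj₁ u)       = ι u
    ι′ (inj₂ (u , i)) = E.elem u i

    same-parent : ∀ {u v w} → L w → ι u ∼ w → ι v ∼ w → u ≡ v
    same-parent {u} {v} l u∼w v∼w = injective (parent-unique l (sound u) (sound v) u∼w v∼w)

    injective′ : ∀ u v → ι′ u ≡ ι′ v → u ≡ v
    injective′ (inj₁ u) (inj₁ v) eq = cong inj₁ (injective eq)
    injective′ (inj₁ u) (inj₂ (v , j)) eq =
      contradiction (subst L (sym eq) (proj₁ (E.sound v j))) (disjoint (sound u))
    injective′ (inj₂ (u , i)) (inj₁ v) eq =
      contradiction (subst L eq (proj₁ (E.sound u i))) (disjoint (sound v))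
    injective′ (inj₂ (u , i)) (inj₂ (v , j)) eq
      -- The parents have to be identified first: only then do `i` and `j` have the same type.
      with refl ← same-parent (proj₁ (E.sound v j))
                    (subst (ι u ∼_) eq (proj₂ (E.sound u i))) (proj₂ (E.sound v j))
      = cong (λ i → inj₂ (u , i)) (E.injective u eq)

    complete′ : ∀ v → Q v ⊎ L v → ∃[ u ] ι′ u ≡ v
    complete′ v (inj₁ q) = let u , eq = complete v q in inj₁ u , eq
    complete′ w (inj₂ l) with parent l
    ... | u , q , u∼w with complete u q
    ...   | v , refl = let i , eq = E.complete v w (l , u∼w) in inj₂ (v , i) , eq

    adjacency′ : ∀ u v → (Graph._∼_ (attachLeaves H k) u v) ⇔ (ι′ u ∼ ι′ v)
    adjacency′ (inj₁ u) (inj₁ v) = adjacency u v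
    adjacency′ (inj₁ u) (inj₂ (v , j)) =
      mk⇔ (λ { refl → proj₂ (E.sound v j) })
          (λ u∼ → same-parent (proj₁ (E.sound v j)) u∼ (proj₂ (E.sound v j)))
    adjacency′ (inj₂ (u , i)) (inj₁ v) =
      mk⇔ (λ { refl → ∼-sym (proj₂ (E.sound u i)) })
          (λ ∼v → same-parent (proj₁ (E.sound u i)) (proj₂ (E.sound u i)) (∼-sym ∼v))
    adjacency′ (inj₂ (u , i)) (inj₂ (v , j)) =
      mk⇔ (λ ()) (indep (proj₁ (E.sound u i)) (proj₁ (E.sound v j)))

module _ {n} (T : Graph (Fin n)) where
  open Graph T

  induced-K₁ : ∀ x → Induced T (K 1) (_≡ x)
  induced-K₁ x = record
    { ι         = const x
    ; injective = λ { {zero} {zero} _ → refl }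
    ; sound     = λ _ → refl
    ; complete  = λ v v≡x → zero , sym v≡x
    ; adjacency = λ { zero zero → mk⇔ (λ 0≢0 → contradiction refl 0≢0)
                                      (λ x∼x → contradiction x∼x (∼-irrefl refl)) }
    }

  induced-K₂ : ∀ {x y} → x ∼ y → Induced T (K 2) (λ v → v ≡ x ⊎ v ≡ y)
  induced-K₂ {x} {y} x∼y = record
    { ι         = λ { zero → x ; (suc zero) → y }
    ; injective = λ { {zero} {zero} _ → refl
                    ; {zero} {suc zero} x≡y → contradiction x≡y (adjacent⇒≢ T x∼y)
                    ; {suc zero} {zero} y≡x → contradiction (sym y≡x) (adjacent⇒≢ T x∼y)
                    ; {suc zero} {suc zero} _ → refl }
    ; sound     = λ { zero → inj₁ refl ; (suc zero) → inj₂ refl }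
    ; complete  = λ { v (inj₁ v≡x) → zero , sym v≡x ; v (inj₂ v≡y) → suc zero , sym v≡y }
    ; adjacency = λ { zero zero → mk⇔ (λ 0≢0 → contradiction refl 0≢0)
                                      (λ x∼x → contradiction x∼x (∼-irrefl refl))
                    ; zero (suc zero) → mk⇔ (λ _ → x∼y) (λ _ ())
                    ; (suc zero) zero → mk⇔ (λ _ → ∼-sym x∼y) (λ _ ())
                    ; (suc zero) (suc zero) → mk⇔ (λ 1≢1 → contradiction refl 1≢1)
                                                  (λ y∼y → contradiction y∼y (∼-irrefl refl)) }
    }

module _ {n} {P : Pred (Fin n) 0ℓ} where

  enumeration-∅ : (∀ v → ¬ P v) → Enumeration P 0
  enumeration-∅ ¬P = record
    { elem      = λ ()
    ; injective = λ { {()} }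
    ; sound     = λ ()
    ; complete  = λ v pv → contradiction pv (¬P v)
    }

  enumeration-size≥1 : ∀ {m} → Enumeration P m → ∃ P → 1 ≤ m
  enumeration-size≥1 {zero} E (v , pv) with () ← proj₁ (Enumeration.complete E v pv)
  enumeration-size≥1 {suc m} E _ = s≤s z≤n

  enumeration-size≡0 : ∀ {m} → Enumeration P m → (∀ v → ¬ P v) → m ≡ 0
  enumeration-size≡0 {zero}  E ¬P = refl
  enumeration-size≡0 {suc m} E ¬P = contradiction (Enumeration.sound E zero) (¬P _)

-- Classification of the acyclic graphs with a layering.

Families : {V : Set} → Graph V → Set
Families T = IsStar T ⊎ Family𝒜 T ⊎ Familyℬ T ⊎ Family𝒞 T

module Classification {n} (T : Graph (Fin n)) (acyclic : Acyclic T)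
                      (neighbour : ∀ v → ∃[ w ] Graph._∼_ T v w) (L : Layering T) where
  open Graph T hiding (_≟_)
  open Layering L

  layer-clash : ∀ {v k l} → layer v ≡ k → layer v ≡ l → k ≢ l → {A : Set} → A
  layer-clash eq eq′ k≢l = contradiction (trans (sym eq) eq′) k≢l

  core≁leaf : ∀ {v w} → layer v ≡ core → layer w ≡ leaf → ¬ (v ∼ w)
  core≁leaf cv lw v∼w = layer-clash cv (leaf-support lw (∼-sym v∼w)) λ ()

  core-or-support : ∀ v → layer v ≢ leaf → layer v ≡ core ⊎ layer v ≡ support
  core-or-support v v≢leaf with layer v
  ... | core    = inj₁ refl
  ... | support = inj₂ refl
  ... | leaf    = contradiction refl v≢leaf

  -- Two distinct core neighbours of `s` would be adjacent and form a triangle with it.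
  core-nbr-unique : ∀ {s u v} → layer u ≡ core → layer v ≡ core → u ∼ s → v ∼ s → u ≡ v
  core-nbr-unique {s} {u} {v} cu cv u∼s v∼s = decidable-stable (u Fin.≟ v) λ u≢v →
    no-triangle T acyclic u∼s (∼-sym v∼s) (∼-sym (core-clique cu cv u≢v))

  core≤2 : ∀ {x y v} → x ≢ y → layer x ≡ core → layer y ≡ core → layer v ≡ core →
           v ≡ x ⊎ v ≡ y
  core≤2 {x} {y} {v} x≢y cx cy cv with v Fin.≟ x | v Fin.≟ y
  ... | yes v≡x | _       = inj₁ v≡x
  ... | no  _   | yes v≡y = inj₂ v≡y
  ... | no  v≢x | no  v≢y = ⊥-elim (no-triangle T acyclic
    (core-clique cx cy x≢y) (core-clique cy cv (≢-sym v≢y)) (core-clique cv cx v≢x))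

  -- Adjacent `s` and `t` have core neighbours `p` and `q`. If these coincide there is a triangle,
  -- otherwise the edge between them closes a 4-cycle.
  support-independent : ∀ {s t} → layer s ≡ support → layer t ≡ support → ¬ (s ∼ t)
  support-independent ss st s∼t with support-core ss | support-core st
  ... | p , s∼p , cp | q , t∼q , cq with p Fin.≟ q
  ...   | yes refl = no-triangle T acyclic s∼t t∼q (∼-sym s∼p)
  ...   | no  p≢q  = no-4-cycle T acyclic (λ { refl → layer-clash ss cq λ () })
                       (λ { refl → layer-clash st cp λ () })
                       s∼p (core-clique cp cq p≢q) (∼-sym t∼q) (∼-sym s∼t)

  -- The last level of the construction, with `k m` the number of leaf-layer neighbours of a middle
  -- vertex. It is positive at support vertices and zero at core vertices; the central vertices are
  -- core and so receive nothing, as `atLeaves` prescribes.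
  attach-leaf-layer : ∀ {C M : Set} {H : Graph (C ⊎ M)}
    (I : Induced T H (λ v → layer v ≢ leaf)) → let open Induced I in
    (∀ c → layer (ι (inj₁ c)) ≡ core) →
    Σ (M → ℕ) λ k → (∀ m → layer (ι (inj₂ m)) ≡ support → 1 ≤ k m)
                  × (∀ m → layer (ι (inj₂ m)) ≡ core → k m ≡ 0)
                  × T ≅ attachLeaves H (atLeaves k)
  attach-leaf-layer {C} {M} {H} I ι-core =
      (λ m → proj₁ (leaves-at m))
    , (λ m sm → enumeration-size≥1 (proj₂ (leaves-at m))
        (let w , ∼w , lw = support-leaf sm in w , lw , ∼w))
    , (λ m cm → enumeration-size≡0 (proj₂ (leaves-at m)) (λ { w (lw , ∼w) → core≁leaf cm lw ∼w }))
    , induced⇒≅ (attach I (λ v≢leaf lv → v≢leaf lv)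
                   (λ lu lv u∼v → layer-clash lv (leaf-support lu u∼v) λ ())
                   (λ {w} lw → let u , w∼u = neighbour w in
                     u , (λ lu → layer-clash lu (leaf-support lw w∼u) λ ()) , ∼-sym w∼u)
                   (λ lw _ _ u∼w v∼w → leaf-unique lw (∼-sym u∼w) (∼-sym v∼w))
                   enum)
                total
    where
    open Induced I
    leaves-at : ∀ m → ∃ (Enumeration (λ w → layer w ≡ leaf × ι (inj₂ m) ∼ w))
    leaves-at m = enumerateDec λ w → (layer w Fin.≟ leaf) ×-dec (ι (inj₂ m) ∼? w)
    enum : ∀ v → Enumeration (λ w → layer w ≡ leaf × ι v ∼ w) (atLeaves (proj₁ ∘ leaves-at) v)
    enum (inj₁ c) = enumeration-∅ λ { w (lw , ∼w) → core≁leaf (ι-core c) lw ∼w }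
    enum (inj₂ m) = proj₂ (leaves-at m)
    total : ∀ v → layer v ≢ leaf ⊎ layer v ≡ leaf
    total v with layer v Fin.≟ leaf
    ... | yes lv = inj₂ lv
    ... | no ¬lv = inj₁ ¬lv

  -- Two adjacent spokes would form a triangle with the centre `z`.
  induced-star : ∀ {t z} {L : Pred (Fin n) 0ℓ} → (∀ {v} → L v → v ≢ z × z ∼ v) →
                 Enumeration (λ v → L v × z ∼ v) t → Induced T (star t) (λ v → v ≡ z ⊎ L v)
  induced-star {z = z} spoke E = attach (induced-K₁ T z)
    (λ v≡z l → proj₁ (spoke l) v≡z)
    (λ lu lv u∼v → no-triangle T acyclic (proj₂ (spoke lu)) u∼v (∼-sym (proj₂ (spoke lv))))
    (λ l → z , refl , proj₂ (spoke l))
    (λ { _ refl refl _ _ → refl })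
    (λ _ → E)

  spokes⇒star : ∀ z → (∀ v → v ≢ z → z ∼ v) → IsStar T
  spokes⇒star z spoke with enumerateDec (λ v → ¬? (v Fin.≟ z) ×-dec (z ∼? v))
  ... | t , E = t , enumeration-size≥1 E (let w , z∼w = neighbour z in
                      w , ≢-sym (adjacent⇒≢ T z∼w) , z∼w)
                  , induced⇒≅ (induced-star (λ v≢z → v≢z , spoke _ v≢z) E) total
    where
    total : ∀ v → v ≡ z ⊎ v ≢ z
    total v with v Fin.≟ z
    ... | yes v≡z = inj₁ v≡z
    ... | no  v≢z = inj₂ v≢z

  -- This covers a core with one vertex and a core with two vertices of which one has no support
  -- neighbour. The number of spokes then separates stars from the families 𝒜 and ℬ.
  module Hub {x} (cx : layer x ≡ core) (hub : ∀ v → v ≢ x → layer v ≢ leaf → x ∼ v) where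

    Spoke : Pred (Fin n) 0ℓ
    Spoke v = v ≢ x × layer v ≢ leaf

    spokes : ∃ (Enumeration (λ v → Spoke v × x ∼ v))
    spokes = enumerateDec λ v → (¬? (v Fin.≟ x) ×-dec ¬? (layer v Fin.≟ leaf)) ×-dec (x ∼? v)

    x≢leaf : layer x ≢ leaf
    x≢leaf lx = layer-clash cx lx λ ()

    neighbour-spoke : ∃[ v ] Spoke v × x ∼ v
    neighbour-spoke with neighbour x
    ... | v , x∼v = v , (≢-sym (adjacent⇒≢ T x∼v) , λ lv → core≁leaf cx lv x∼v) , x∼v

    -- The star is centred at `z` and not at `x`. A leaf-layer vertex has a neighbour, which is
    -- neither `x` nor in the leaf layer, so it is the only spoke.
    single-spoke : ∀ z → Spoke z → (∀ v → Spoke v → v ≡ z) → ∀ v → v ≢ z → z ∼ v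
    single-spoke z (z≢x , z≢leaf) only v v≢z with v Fin.≟ x | layer v Fin.≟ leaf
    ... | yes refl | _         = ∼-sym (hub z z≢x z≢leaf)
    ... | no v≢x   | no v≢leaf = contradiction (only v (v≢x , v≢leaf)) v≢z
    ... | no v≢x   | yes lv    with neighbour v
    ...   | w , v∼w = subst (_∼ v) (only w (w≢x , w≢leaf)) (∼-sym v∼w)
      where
      w≢x : w ≢ x
      w≢x refl = core≁leaf cx lv (∼-sym v∼w)
      w≢leaf : layer w ≢ leaf
      w≢leaf lw = layer-clash lw (leaf-support lv v∼w) λ ()

    module _ {t} (E : Enumeration (λ v → Spoke v × x ∼ v) t) where
      open Enumeration E using (elem)

      core-star : Induced T (star t) (λ v → layer v ≢ leaf)
      core-star = induced-resp (induced-star (λ (v≢x , v≢leaf) → v≢x , hub _ v≢x v≢leaf) E)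
        (λ { (inj₁ refl) → x≢leaf ; (inj₂ (_ , v≢leaf)) → v≢leaf }) split
        where
        split : ∀ {v} → layer v ≢ leaf → v ≡ x ⊎ Spoke v
        split {v} v≢leaf with v Fin.≟ x
        ... | yes v≡x = inj₁ v≡x
        ... | no  v≢x = inj₂ (v≢x , v≢leaf)

      open Induced core-star

      other-core? : Dec (∃[ y ] y ≢ x × layer y ≡ core)
      other-core? = Fin.any? λ y → ¬? (y Fin.≟ x) ×-dec (layer y Fin.≟ core)

      -- A second core vertex `y` is a spoke without leaves, and it is the exceptional leaf of ℬ; as
      -- the core has at most two vertices, all other spokes are support vertices. Without such a
      -- `y` every spoke is a support vertex, which gives 𝒜.
      𝒜-or-ℬ : 2 ≤ t → Family𝒜 T ⊎ Familyℬ T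
      𝒜-or-ℬ 2≤t with attach-leaf-layer core-star (λ _ → cx) | other-core?
      ... | k , k≥1 , k≡0 , T≅ | no no-other =
        inj₁ (t , 2≤t , k , (λ m → k≥1 m (supports m)) , T≅)
        where
        supports : ∀ m → layer (ι (inj₂ m)) ≡ support
        supports m@(_ , i) with (m≢x , m≢leaf) , _ ← Enumeration.sound E i
                           with core-or-support _ m≢leaf
        ... | inj₁ cm = contradiction (_ , m≢x , cm) no-other
        ... | inj₂ sm = sm
      ... | k , k≥1 , k≡0 , T≅ | yes (y , y≢x , cy) =
        inj₂ (t , 2≤t , k , ŷ , k≡0 ŷ (trans (cong layer ιŷ≡y) cy) ,
              (λ m m≢ŷ → k≥1 m (supports m m≢ŷ)) , T≅)
        where
        y-spoke : Spoke y
        y-spoke = y≢x , λ ly → layer-clash cy ly λ ()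
        ŷ : StarLeaf t
        ŷ = zero , proj₁ (Enumeration.complete E y (y-spoke , hub y y≢x (proj₂ y-spoke)))
        ιŷ≡y : ι (inj₂ ŷ) ≡ y
        ιŷ≡y = proj₂ (Enumeration.complete E y (y-spoke , hub y y≢x (proj₂ y-spoke)))
        supports : ∀ m → m ≢ ŷ → layer (ι (inj₂ m)) ≡ support
        supports m@(zero , i) m≢ŷ with (m≢x , m≢leaf) , _ ← Enumeration.sound E i
                                  with core-or-support _ m≢leaf
        ... | inj₂ sm = sm
        ... | inj₁ cm with core≤2 (≢-sym y≢x) cx cy cm
        ...   | inj₁ m≡x = contradiction m≡x m≢x
        ...   | inj₂ m≡y =
          contradiction (cong (zero ,_) (Enumeration.injective E (trans m≡y (sym ιŷ≡y)))) m≢ŷ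

    classify : ∀ {t} → Enumeration (λ v → Spoke v × x ∼ v) t → Families T
    classify {zero} E with () ← enumeration-size≥1 E neighbour-spoke
    classify {suc zero} E with Enumeration.sound E zero
    ... | z-spoke , _ = inj₁ (spokes⇒star _ (single-spoke _ z-spoke only))
      where
      only : ∀ v → Spoke v → v ≡ Enumeration.elem E zero
      only v v-spoke with Enumeration.complete E v (v-spoke , hub v (proj₁ v-spoke) (proj₂ v-spoke))
      ... | zero , eq = sym eq
    classify {suc (suc t)} E with 𝒜-or-ℬ E (s≤s (s≤s z≤n))
    ... | inj₁ 𝒜 = inj₂ (inj₁ 𝒜)
    ... | inj₂ ℬ = inj₂ (inj₂ (inj₁ ℬ))

    families : Families T
    families = classify (proj₂ spokes)

  SupportAt : Fin n → Pred (Fin n) 0ℓ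
  SupportAt x v = layer v ≡ support × x ∼ v

  supportAt? : ∀ x → Decidable₁ (SupportAt x)
  supportAt? x v = (layer v Fin.≟ support) ×-dec (x ∼? v)

  module TwoCores {x y} (cx : layer x ≡ core) (cy : layer y ≡ core) (x≢y : x ≢ y) where

    x∼y : x ∼ y
    x∼y = core-clique cx cy x≢y

    support-xy : ∀ {s} → layer s ≡ support → x ∼ s ⊎ y ∼ s
    support-xy ss with support-core ss
    ... | w , s∼w , cw with core≤2 x≢y cx cy cw
    ...   | inj₁ refl = inj₁ (∼-sym s∼w)
    ...   | inj₂ refl = inj₂ (∼-sym s∼w)

    hub : ¬ ∃ (SupportAt y) → ∀ v → v ≢ x → layer v ≢ leaf → x ∼ v
    hub y-bare v v≢x v≢leaf with core-or-support v v≢leaf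
    ... | inj₁ cv = core-clique cx cv (≢-sym v≢x)
    ... | inj₂ sv with support-xy sv
    ...   | inj₁ x∼v = x∼v
    ...   | inj₂ y∼v = contradiction (v , sv , y∼v) y-bare

    xy-core : ∀ {v} → v ≡ x ⊎ v ≡ y → layer v ≡ core
    xy-core (inj₁ refl) = cx
    xy-core (inj₂ refl) = cy

    -- The support vertices at `x` and those at `y` give the numbers `a` and `b`. No support vertex
    -- is counted twice, since it would form a triangle with `x` and `y`.
    family𝒞 : ∃ (SupportAt x) → ∃ (SupportAt y) → Family𝒞 T
    family𝒞 sx sy with enumerateDec (supportAt? x) | enumerateDec (supportAt? y)
    ... | a , Ex | b , Ey = finish
      where
      enum : ∀ c → Enumeration (λ w → layer w ≡ support × Induced.ι (induced-K₂ T x∼y) c ∼ w)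
                               (lookup (a ∷ b ∷ []) c)
      enum zero       = Ex
      enum (suc zero) = Ey

      split : ∀ {v} → layer v ≢ leaf → (v ≡ x ⊎ v ≡ y) ⊎ layer v ≡ support
      split {v} v≢leaf with core-or-support v v≢leaf
      ... | inj₁ cv = inj₁ (core≤2 x≢y cx cy cv)
      ... | inj₂ sv = inj₂ sv

      parent : ∀ {s} → layer s ≡ support → ∃[ u ] (u ≡ x ⊎ u ≡ y) × u ∼ s
      parent ss with support-xy ss
      ... | inj₁ x∼s = x , inj₁ refl , x∼s
      ... | inj₂ y∼s = y , inj₂ refl , y∼s

      I : Induced T (doubleStar a b) (λ v → layer v ≢ leaf)
      I = induced-resp
        (attach (induced-K₂ T x∼y)
          (λ q sv → layer-clash (xy-core q) sv λ ())
          support-independent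
          parent
          (λ _ qu qv → core-nbr-unique (xy-core qu) (xy-core qv))
          enum)
        (λ { (inj₁ q) lv → layer-clash (xy-core q) lv λ ()
           ; (inj₂ sv) lv → layer-clash sv lv λ () })
        split

      supports : ∀ m → layer (Induced.ι I (inj₂ m)) ≡ support
      supports (c , i) = proj₁ (Enumeration.sound (enum c) i)

      finish : Family𝒞 T
      finish with attach-leaf-layer I (λ { zero → cx ; (suc zero) → cy })
      ... | k , k≥1 , _ , T≅ =
        a , b , enumeration-size≥1 Ex sx , enumeration-size≥1 Ey sy , k ,
        (λ m → k≥1 m (supports m)) , T≅

  some-core : Fin n → ∃[ x ] layer x ≡ core
  some-core v with layer v in eq
  ... | core    = v , eq
  ... | support = let w , _ , cw = support-core eq in w , cw
  ... | leaf    = let _ , v∼w = neighbour v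
                      u , _ , cu = support-core (leaf-support eq v∼w) in u , cu

  families : Fin n → Families T
  families v₀ with some-core v₀
  ... | x , cx with Fin.any? (λ y → ¬? (x Fin.≟ y) ×-dec (layer y Fin.≟ core))
  ...   | no only = Hub.families cx hub
    where
    hub : ∀ v → v ≢ x → layer v ≢ leaf → x ∼ v
    hub v v≢x v≢leaf with core-or-support v v≢leaf
    ... | inj₁ cv = contradiction (v , ≢-sym v≢x , cv) only
    ... | inj₂ sv with support-core sv
    ...   | w , v∼w , cw with x Fin.≟ w
    ...     | yes refl = ∼-sym v∼w
    ...     | no  x≢w  = contradiction (w , x≢w , cw) only
  -- If one of the two core vertices has no support neighbour, the other one is adjacent to all
  -- remaining vertices outside the leaf layer.
  ...   | yes (y , x≢y , cy) with Fin.any? (supportAt? x) | Fin.any? (supportAt? y)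
  ...     | yes sx | yes sy = inj₂ (inj₂ (inj₂ (TwoCores.family𝒞 cx cy x≢y sx sy)))
  ...     | _      | no ¬sy = Hub.families cx (TwoCores.hub cx cy x≢y ¬sy)
  ...     | no ¬sx | _      = Hub.families cy (TwoCores.hub cy cx (≢-sym x≢y) ¬sx)

-- Layerings of the listed trees.

≅-layering : ∀ {V W} {G : Graph V} {H : Graph W} → G ≅ H → Layering H → Layering G
≅-layering {V} {W} {G} {H} G≅H L = record
  { layer        = layer ∘ to
  ; core-clique  = λ cu cv u≢v → reflect (core-clique cu cv (u≢v ∘ injective))
  ; support-core = λ sv → pull (support-core sv)
  ; support-leaf = λ sv → pull (support-leaf sv)
  ; leaf-support = λ lv v∼w → leaf-support lv (preserve v∼w)
  ; leaf-unique  = λ lv v∼u v∼w → injective (leaf-unique lv (preserve v∼u) (preserve v∼w))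
  }
  where
  open Layering L
  open _≅_ G≅H
  open Inverse bijection using (from; strictlyInverseˡ; strictlyInverseʳ)
  module G = Graph G
  module H = Graph H

  injective : ∀ {u v} → to u ≡ to v → u ≡ v
  injective {u} {v} eq =
    trans (sym (strictlyInverseʳ u)) (trans (cong from eq) (strictlyInverseʳ v))

  preserve : ∀ {u v} → u G.∼ v → to u H.∼ to v
  preserve {u} {v} = Equivalence.to (adjacency u v)

  reflect : ∀ {u v} → to u H.∼ to v → u G.∼ v
  reflect {u} {v} = Equivalence.from (adjacency u v)

  pull : ∀ {v l} → ∃[ w ] to v H.∼ w × layer w ≡ l → ∃[ w ] v G.∼ w × layer (to w) ≡ l
  pull {v} {l} (w , v∼w , lw) =
    from w , reflect (subst (to v H.∼_) (sym (strictlyInverseˡ w)) v∼w)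
           , trans (cong layer (strictlyInverseˡ w)) lw

-- In the single edge both vertices form the core and the ESI-set is empty. For `t ≥ 2` the centre
-- is the only support vertex, one pendant vertex is the core, and the others form the ESI-set.
star-layering : ∀ t → 1 ≤ t → Layering (star t)
star-layering (suc zero) _ = record
  { layer        = λ _ → core
  ; core-clique  = λ { {inj₁ zero} {inj₁ zero} _ _ u≢v → contradiction refl u≢v
                     ; {inj₁ zero} {inj₂ (zero , zero)} _ _ _ → refl
                     ; {inj₂ (zero , zero)} {inj₁ zero} _ _ _ → refl
                     ; {inj₂ (zero , zero)} {inj₂ (zero , zero)} _ _ u≢v → contradiction refl u≢v }
  ; support-core = λ ()
  ; support-leaf = λ ()
  ; leaf-support = λ ()
  ; leaf-unique  = λ ()
  }
star-layering (suc (suc t)) _ = record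
  { layer        = λ { (inj₁ _) → support
                     ; (inj₂ (_ , zero)) → core
                     ; (inj₂ (_ , suc _)) → leaf }
  ; core-clique  = λ { {inj₂ (zero , zero)} {inj₂ (zero , zero)} _ _ u≢v → contradiction refl u≢v }
  ; support-core = λ { {inj₁ zero} _ → inj₂ (zero , zero) , refl , refl
                     ; {inj₂ (_ , zero)} () ; {inj₂ (_ , suc _)} () }
  ; support-leaf = λ { {inj₁ zero} _ → inj₂ (zero , suc zero) , refl , refl
                     ; {inj₂ (_ , zero)} () ; {inj₂ (_ , suc _)} () }
  ; leaf-support = λ { {inj₂ (_ , suc _)} {inj₁ _} _ _ → refl }
  ; leaf-unique  = λ { {inj₂ (_ , suc _)} {inj₁ _} {inj₁ _} _ refl refl → refl }
  }

-- A pendant vertex of the inner graph that receives no new leaves belongs to the core.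
module _ (c : ℕ) (m : Fin c → ℕ) (k : Σ (Fin c) (Fin ∘ m) → ℕ)
         (bare-adjacent : ∀ l x → k l ≡ 0 → proj₁ l ≡ x)
         (bare-unique : ∀ l l′ → k l ≡ 0 → k l′ ≡ 0 → l ≡ l′) where

  private
    M : Set
    M = Σ (Fin c) (Fin ∘ m)

    G : Graph ((Fin c ⊎ M) ⊎ Σ (Fin c ⊎ M) (Fin ∘ atLeaves k))
    G = attachLeaves (attachLeaves (K c) m) (atLeaves k)

    open Graph G

    V : Set
    V = (Fin c ⊎ M) ⊎ Σ (Fin c ⊎ M) (Fin ∘ atLeaves k)

    middle : ℕ → Layer
    middle zero    = core
    middle (suc _) = support

    layer : V → Layer
    layer (inj₁ (inj₁ _)) = core
    layer (inj₁ (inj₂ l)) = middle (k l)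
    layer (inj₂ _)        = leaf

    middle-core : ∀ {d} → middle d ≡ core → d ≡ 0
    middle-core {zero} _ = refl

    middle-inhabited : ∀ {d} → Fin d → middle d ≡ support
    middle-inhabited {suc d} _ = refl

    middle-support : ∀ {d} → middle d ≡ support → Fin d
    middle-support {suc d} _ = zero

    middle≢leaf : ∀ {d} → middle d ≢ leaf
    middle≢leaf {zero} ()
    middle≢leaf {suc d} ()

    -- The two assumptions on bare pendant vertices enter here: such a vertex is adjacent to every
    -- central vertex, and there is at most one of them.
    core-clique : ∀ u v → layer u ≡ core → layer v ≡ core → u ≢ v → u ∼ v
    core-clique (inj₁ (inj₁ x)) (inj₁ (inj₁ y)) _ _ u≢v = u≢v ∘ cong (inj₁ ∘ inj₁)
    core-clique (inj₁ (inj₁ x)) (inj₁ (inj₂ l)) _ cl _ = sym (bare-adjacent l x (middle-core cl))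
    core-clique (inj₁ (inj₂ l)) (inj₁ (inj₁ x)) cl _ _ = bare-adjacent l x (middle-core cl)
    core-clique (inj₁ (inj₂ l)) (inj₁ (inj₂ l′)) cl cl′ u≢v =
      contradiction (cong (inj₁ ∘ inj₂) (bare-unique l l′ (middle-core cl) (middle-core cl′))) u≢v

    support-core : ∀ v → layer v ≡ support → ∃[ w ] v ∼ w × layer w ≡ core
    support-core (inj₁ (inj₂ (x , _))) _ = inj₁ (inj₁ x) , refl , refl

    support-leaf : ∀ v → layer v ≡ support → ∃[ w ] v ∼ w × layer w ≡ leaf
    support-leaf (inj₁ (inj₂ l)) sl = inj₂ (inj₂ l , middle-support sl) , refl , refl

    leaf-support : ∀ v w → layer v ≡ leaf → v ∼ w → layer w ≡ support
    leaf-support (inj₁ (inj₂ l)) _ ll _ = contradiction ll middle≢leaf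
    leaf-support (inj₂ (inj₂ l , i)) (inj₁ _) _ refl = middle-inhabited i

    leaf-unique : ∀ v u w → layer v ≡ leaf → v ∼ u → v ∼ w → u ≡ w
    leaf-unique (inj₁ (inj₂ l)) _ _ ll _ _ = contradiction ll middle≢leaf
    leaf-unique (inj₂ _) (inj₁ _) (inj₁ _) _ refl refl = refl

  two-level-layering : Layering G
  two-level-layering = record
    { layer        = layer
    ; core-clique  = λ {u} {v} → core-clique u v
    ; support-core = λ {v} → support-core v
    ; support-leaf = λ {v} → support-leaf v
    ; leaf-support = λ {v} {w} → leaf-support v w
    ; leaf-unique  = λ {v} {u} {w} → leaf-unique v u w
    }

1≤⇒≢0 : ∀ {k} → 1 ≤ k → k ≢ 0
1≤⇒≢0 (s≤s _) ()

families⇒layering : {V : Set} {T : Graph V} → Families T → Layering T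
families⇒layering (inj₁ (t , 1≤t , T≅)) = ≅-layering T≅ (star-layering t 1≤t)
families⇒layering (inj₂ (inj₁ (t , _ , k , k≥1 , T≅))) =
  ≅-layering T≅ (two-level-layering 1 (const t) k
    -- In 𝒜, and likewise in 𝒞 below, no pendant vertex is bare, so both conditions hold vacuously.
    (λ l _ kl≡0 → contradiction kl≡0 (1≤⇒≢0 (k≥1 l)))
    (λ l _ kl≡0 → contradiction kl≡0 (1≤⇒≢0 (k≥1 l))))
families⇒layering (inj₂ (inj₂ (inj₁ (t , _ , k , y , _ , k≥1 , T≅)))) =
  ≅-layering T≅ (two-level-layering 1 (const t) k
    -- The centre `K 1` has a single vertex, and the bare vertex `y` hangs at it.
    (λ { (zero , _) zero _ → refl })
    (λ l l′ kl≡0 kl′≡0 → trans (bare l kl≡0) (sym (bare l′ kl′≡0))))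
  where
  bare : ∀ l → k l ≡ 0 → l ≡ y
  bare l kl≡0 = decidable-stable (l ≟ y) λ l≢y → 1≤⇒≢0 (k≥1 l l≢y) kl≡0
    where
    _≟_ : (l l′ : StarLeaf t) → Dec (l ≡ l′)
    _≟_ = Product.≡-dec Fin._≟_ Fin._≟_
families⇒layering (inj₂ (inj₂ (inj₂ (a , b , _ , _ , k , k≥1 , T≅)))) =
  ≅-layering T≅ (two-level-layering 2 (lookup (a ∷ b ∷ [])) k
    (λ l _ kl≡0 → contradiction kl≡0 (1≤⇒≢0 (k≥1 l)))
    (λ l _ kl≡0 → contradiction kl≡0 (1≤⇒≢0 (k≥1 l))))

-- The equality is written additively to avoid truncated subtraction; both directions pass through a
-- layering.
theorem20 : (n : ℕ) (T : Graph (Fin n)) → 2 ≤ n → IsTree T →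
    (αₑₛ T + 1 ≡ α T) ⇔ (IsStar T ⊎ Family𝒜 T ⊎ Familyℬ T ⊎ Family𝒞 T)
theorem20 n T 2≤n (connected , acyclic) = mk⇔
  (λ αₑₛ+1≡α → Classification.families T acyclic neighbour
                 (αₑₛ+1≡α⇒layering T acyclic αₑₛ+1≡α) v₀)
  (λ family → layering⇒αₑₛ+1≡α T (v₀ , neighbour v₀) (families⇒layering family))
  where
  v₀ : Fin n
  v₀ = fromℕ< (ℕ.≤-trans (s≤s z≤n) 2≤n)
  neighbour : ∀ v → ∃[ w ] Graph._∼_ T v w
  neighbour = connected⇒neighbour {G = T} 2≤n connected
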